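{- For every integer $k \geq 1$ there exists $n_0$ such that for all $n \geq n_0$ we have $\mathrm{vp}(K(n,k)) = \binom{n-k}{k}$.
   Context: All graphs are finite, undirected and simple. The Kneser graph $K(n,k)$ has as vertices all $k$-subsets of $\{1,2,\dots,n\}$, with an edge between two such subsets if and only if they are disjoint. A $u,v$-geodesic is a shortest $u,v$-path. For a vertex $x$ of $G$, a set $S \subseteq V(G)$ is an $x$-position set if for every $y \in S$ no vertex of $S \setminus \{y\}$ lies on any $x,y$-geodesic in $G$. The $x$-position number $p_x(G)$ is the maximum cardinality of an $x$-position set of $G$. Define $\mathrm{vp}(G) = \max_{x \in V(G)} p_x(G)$. -}

module Defs where

open import Data.Fin.Subset using (Subset; Empty; _∩_; ∣_∣; inside; outside)
open import Data.Fin.Subset.Properties using (Empty-unique; ∣⊥∣≡0; ∩-idem; ∩-comm)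
open import Data.List.Base using (List; []; _∷_; [_]; _++_; length; map)
open import Data.List.Membership.Propositional using (_∈_; _∉_)
open import Data.List.Membership.Propositional.Properties
  using (∈-map⁺; ∈-map⁻; ∈-++⁺ˡ; ∈-++⁺ʳ)
open import Data.List.Relation.Unary.Any using (here)
open import Data.List.Relation.Unary.All as All using ()
open import Data.List.Relation.Unary.AllPairs as AllPairs using ()
open import Data.List.Relation.Unary.Unique.Propositional using (Unique)
open import Data.List.Relation.Unary.Unique.Propositional.Properties using (map⁺; ++⁺)
open import Data.Nat.Base using (ℕ; zero; suc; _≤_; NonZero; ≢-nonZero⁻¹)
open import Data.Nat.Properties using (≡-irrelevant)
open import Data.Product.Base using (Σ; Σ-syntax; ∃; ∃-syntax; _×_; _,_; proj₁)
open import Data.Vec.Base using ([]; _∷_)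
open import Data.Vec.Properties using (∷-injectiveʳ)
open import Relation.Binary.Construct.Closure.ReflexiveTransitive using (Star; ε; _◅_)
open import Relation.Binary.Definitions using (Symmetric)
open import Relation.Binary.PropositionalEquality
  using (_≡_; _≢_; refl; sym; trans; cong; subst)
open import Relation.Nullary.Negation using (¬_)

record Graph : Set₁ where
  field
    Vertex         : Set
    Adj            : Vertex → Vertex → Set
    Adj-sym        : Symmetric Adj
    Adj-irrefl     : ∀ {v} → ¬ Adj v v
    vertices       : List Vertex
    vertices-uniq  : Unique vertices
    vertices-all   : ∀ v → v ∈ vertices

_IsMaximumOf_ : ℕ → (ℕ → Set) → Set
m IsMaximumOf P = P m × (∀ j → P j → j ≤ m)

module _ (G : Graph) where
  open Graph G

  Walk : Vertex → Vertex → Set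
  Walk = Star Adj

  walkLength : ∀ {u v} → Walk u v → ℕ
  walkLength ε       = 0
  walkLength (_ ◅ w) = suc (walkLength w)

  walkVertices : ∀ {u v} → Walk u v → List Vertex
  walkVertices {u} ε       = [ u ]
  walkVertices {u} (_ ◅ w) = u ∷ walkVertices w

  IsPath : ∀ {u v} → Walk u v → Set
  IsPath w = Unique (walkVertices w)

  IsGeodesic : ∀ {u v} → Walk u v → Set
  IsGeodesic {u} {v} w =
    IsPath w × (∀ (w′ : Walk u v) → IsPath w′ → walkLength w ≤ walkLength w′)

  -- Sets of vertices are given as lists; wherever a cardinality is taken
  -- the list is required to be duplicate-free.
  IsPositionSet : Vertex → List Vertex → Set
  IsPositionSet x S =
    ∀ {y z} → y ∈ S → z ∈ S → z ≢ y →
    ∀ (w : Walk x y) → IsGeodesic w → z ∉ walkVertices w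

  -- m is p_x(G)
  IsPositionNumber : Vertex → ℕ → Set
  IsPositionNumber x m =
    m IsMaximumOf λ j → ∃[ S ] Unique S × IsPositionSet x S × length S ≡ j

  -- m is vp(G).  The function p, being determined pointwise by
  -- IsPositionNumber, is x ↦ p_x(G).
  IsVp : ℕ → Set
  IsVp m =
    Σ[ p ∈ (Vertex → ℕ) ]
      (∀ x → IsPositionNumber x (p x)) × m IsMaximumOf (λ j → ∃[ x ] p x ≡ j)

KSubset : ℕ → ℕ → Set
KSubset n k = Σ[ s ∈ Subset n ] ∣ s ∣ ≡ k

addOut : ∀ {n k} → KSubset n k → KSubset (suc n) k
addOut (s , eq) = outside ∷ s , eq

addIn : ∀ {n k} → KSubset n k → KSubset (suc n) (suc k)
addIn (s , eq) = inside ∷ s , cong suc eq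

KSubset-≡ : ∀ {n k} {s t : KSubset n k} → proj₁ s ≡ proj₁ t → s ≡ t
KSubset-≡ {s = s , p} {t = _ , q} refl = cong (s ,_) (≡-irrelevant p q)

addOut-injective : ∀ {n k} {s t : KSubset n k} → addOut s ≡ addOut t → s ≡ t
addOut-injective eq = KSubset-≡ (∷-injectiveʳ (cong proj₁ eq))

addIn-injective : ∀ {n k} {s t : KSubset n k} → addIn s ≡ addIn t → s ≡ t
addIn-injective eq = KSubset-≡ (∷-injectiveʳ (cong proj₁ eq))

kSubsets : ∀ n k → List (KSubset n k)
kSubsets zero    zero    = [ [] , refl ]
kSubsets zero    (suc k) = []
kSubsets (suc n) zero    = map addOut (kSubsets n zero)
kSubsets (suc n) (suc k) = map addIn (kSubsets n k) ++ map addOut (kSubsets n (suc k))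

kSubsets-uniq : ∀ n k → Unique (kSubsets n k)
kSubsets-uniq zero    zero    = All.[] AllPairs.∷ AllPairs.[]
kSubsets-uniq zero    (suc k) = AllPairs.[]
kSubsets-uniq (suc n) zero    = map⁺ addOut-injective (kSubsets-uniq n zero)
kSubsets-uniq (suc n) (suc k) =
  ++⁺ (map⁺ addIn-injective (kSubsets-uniq n k))
      (map⁺ addOut-injective (kSubsets-uniq n (suc k)))
      λ { (i , o) → disjoint (∈-map⁻ addIn i) (∈-map⁻ addOut o) }
  where
  disjoint : ∀ {v} → ∃[ s ] s ∈ kSubsets n k × v ≡ addIn s →
             ¬ (∃[ t ] t ∈ kSubsets n (suc k) × v ≡ addOut t)
  disjoint (_ , _ , refl) (_ , _ , ())

kSubsets-all : ∀ n k (s : KSubset n k) → s ∈ kSubsets n k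
kSubsets-all zero    zero    ([] , refl) = here refl
kSubsets-all (suc n) zero    (outside ∷ s , eq) =
  ∈-map⁺ addOut (kSubsets-all n zero (s , eq))
kSubsets-all (suc n) (suc k) (inside ∷ s , refl) =
  ∈-++⁺ˡ (∈-map⁺ addIn (kSubsets-all n k (s , refl)))
kSubsets-all (suc n) (suc k) (outside ∷ s , eq) =
  ∈-++⁺ʳ (map addIn (kSubsets n k)) (∈-map⁺ addOut (kSubsets-all n (suc k) (s , eq)))

-- For k = 0 the empty set is disjoint from itself, so the graph would have
-- a loop.
Kneser : (n k : ℕ) .{{_ : NonZero k}} → Graph
Kneser n k = record
  { Vertex        = KSubset n k
  ; Adj           = λ s t → Empty (proj₁ s ∩ proj₁ t)
  ; Adj-sym       = λ {s} {t} → subst Empty (∩-comm (proj₁ s) (proj₁ t))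
  ; Adj-irrefl    = λ {s} → irrefl s
  ; vertices      = kSubsets n k
  ; vertices-uniq = kSubsets-uniq n k
  ; vertices-all  = kSubsets-all n k
  }
  where
  irrefl : (s : KSubset n k) → ¬ Empty (proj₁ s ∩ proj₁ s)
  irrefl (s , eq) e = ≢-nonZero⁻¹ k (trans (sym eq) (trans (cong ∣_∣ s≡⊥) (∣⊥∣≡0 n)))
    where s≡⊥ = Empty-unique (subst Empty (∩-idem s) e)

-- For n large, K(n,k) has diameter at most 2, and the neighbourhood N(x) is
-- an x-position set of size (n − k) C k for every x.  If an x-position set S
-- has another vertex y ≠ x outside N(x), then S misses all common neighbours
-- of x and y; there are at least (n − 2k) C k of these, which for n large is
-- at least half of all vertices, so |S| ≤ (n − 2k) C k.  Otherwise S ⊆ N(x), or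
-- x ∈ S, which forces S = {x}.
module Submission where

open import Defs
open import Data.Bool.Properties using () renaming (_≟_ to _≟ᵇ_)
open import Data.Fin.Base using (zero; suc; fromℕ<)
open import Data.Fin.Subset
  using (Subset; Empty; _∩_; _∪_; ∣_∣; inside; outside) renaming (_⊆_ to _⊆ˢ_)
open import Data.Fin.Subset.Properties
  using (drop-∷-Empty; nonempty?; ∣p∣≤n; x∈p∩q⁺; x∈p∩q⁻; p⊆p∪q; q⊆p∪q)
open import Data.List.Base using (List; []; _∷_; _++_; length; map; filter; lookup)
open import Data.List.Membership.Propositional using (_∈_; _∉_; find; lose)
open import Data.List.Membership.Propositional.Properties
  using (∈-∃++; ∈-++⁺ˡ; ∈-++⁺ʳ; ∈-++⁻; ∈-filter⁺; ∈-filter⁻)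
open import Data.List.Properties using (length-map; length-++; filter-++)
open import Data.List.Relation.Binary.Subset.Propositional using (_⊆_)
open import Data.List.Relation.Unary.All using ([]; _∷_)
open import Data.List.Relation.Unary.AllPairs using ([]; _∷_)
open import Data.List.Relation.Unary.Any using (here; there; any?)
open import Data.List.Relation.Unary.Unique.Propositional using (Unique)
open import Data.List.Relation.Unary.Unique.Propositional.Properties
  using (++⁺; filter⁺; Unique[x∷xs]⇒x∉xs)
open import Data.Nat.Base
  using (ℕ; zero; suc; _+_; _*_; _≤_; _∸_; z≤n; s≤s; NonZero)
open import Data.Nat.Combinatorics using (_C_; nCk+nC[k+1]≡[n+1]C[k+1]; nCn≡1)
open import Data.Nat.Properties
open import Data.Product.Base using (∃-syntax; _×_; _,_; proj₁; proj₂)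
open import Data.Sum.Base using (inj₁; inj₂)
open import Data.Vec.Base using ([]; _∷_; here; there)
open import Data.Vec.Properties using (≡-dec)
open import Function.Base using (_∘_)
open import Level using (0ℓ)
open import Relation.Binary.Construct.Closure.ReflexiveTransitive using (ε; _◅_)
open import Relation.Binary.Definitions using (DecidableEquality)
open import Relation.Binary.PropositionalEquality
  using (_≡_; _≢_; refl; sym; trans; cong; cong₂; subst; module ≡-Reasoning)
open import Relation.Nullary using (yes; no; ¬_; contradiction; ¬?; _×-dec_)
open import Relation.Unary using (Pred; Decidable)

-- Binomial coefficients

C-≤-suc : ∀ n k → n C k ≤ suc n C k
C-≤-suc n zero    = ≤-refl
C-≤-suc n (suc k) = begin
  n C suc k          ≤⟨ m≤n+m _ (n C k) ⟩
  n C k + n C suc k  ≡⟨ nCk+nC[k+1]≡[n+1]C[k+1] n k ⟩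
  suc n C suc k      ∎
  where open ≤-Reasoning

C-≤-+ : ∀ n d k → n C k ≤ (d + n) C k
C-≤-+ n zero    k = ≤-refl
C-≤-+ n (suc d) k = ≤-trans (C-≤-+ n d k) (C-≤-suc (d + n) k)

C-monoˡ-≤ : ∀ {m n} k → m ≤ n → m C k ≤ n C k
C-monoˡ-≤ {m} {n} k m≤n =
  subst (λ l → m C k ≤ l C k) (m∸n+n≡m m≤n) (C-≤-+ m (n ∸ m) k)

k≤n⇒1≤nCk : ∀ {n k} → k ≤ n → 1 ≤ n C k
k≤n⇒1≤nCk {n} {k} k≤n = subst (_≤ n C k) (nCn≡1 k) (C-monoˡ-≤ k k≤n)

-- Pascal's rule, used `d` times from `n` up to `d + n`, adds `m C k` with `m ≥ n` each time, hence
-- at least `n C k`.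
d*nCk≤[d+n]C[k+1] : ∀ n d k → d * (n C k) ≤ (d + n) C suc k
d*nCk≤[d+n]C[k+1] n zero    k = z≤n
d*nCk≤[d+n]C[k+1] n (suc d) k = begin
  n C k + d * (n C k)            ≤⟨ +-mono-≤ (C-≤-+ n d k) (d*nCk≤[d+n]C[k+1] n d k) ⟩
  (d + n) C k + (d + n) C suc k  ≡⟨ nCk+nC[k+1]≡[n+1]C[k+1] (d + n) k ⟩
  suc (d + n) C suc k            ∎
  where open ≤-Reasoning

-- The same `d` uses of Pascal's rule, now bounded from above: each increment `m C k` has
-- `m < d + n`.
[d+n]C[k+1]≤d*[d+n]Ck+nC[k+1] : ∀ n d k →
  (d + n) C suc k ≤ d * ((d + n) C k) + n C suc k
[d+n]C[k+1]≤d*[d+n]Ck+nC[k+1] n zero    k = ≤-refl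
[d+n]C[k+1]≤d*[d+n]Ck+nC[k+1] n (suc d) k = begin
  suc m C suc k                              ≡⟨ nCk+nC[k+1]≡[n+1]C[k+1] m k ⟨
  m C k + m C suc k                          ≤⟨ +-monoʳ-≤ (m C k) ([d+n]C[k+1]≤d*[d+n]Ck+nC[k+1] n d k) ⟩
  m C k + (d * (m C k) + n C suc k)          ≡⟨ +-assoc (m C k) _ _ ⟨
  suc d * (m C k) + n C suc k                ≤⟨ +-monoˡ-≤ (n C suc k) (*-monoʳ-≤ (suc d) (C-≤-suc m k)) ⟩
  suc d * (suc m C k) + n C suc k            ∎
  where
  open ≤-Reasoning
  m = d + n

-- Induction on k: by Pascal, (d + n) C (k+1) exceeds n C (k+1) by at most
-- d * (d + n) C k ≤ 2d * (n − 2d) C k ≤ n C (k+1), where the first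
-- inequality is the induction hypothesis for a shift by 3d.
eventually-[d+n]Ck≤2*nCk : ∀ k d →
  ∃[ n₀ ] (∀ n → n₀ ≤ n → (d + n) C k ≤ 2 * (n C k))
eventually-[d+n]Ck≤2*nCk zero    d = 0 , λ _ _ → s≤s z≤n
eventually-[d+n]Ck≤2*nCk (suc k) d
  with eventually-[d+n]Ck≤2*nCk k (d + 2 * d)
... | n₀ , ih = 2 * d + n₀ , bound
  where
  bound : ∀ n → 2 * d + n₀ ≤ n → (d + n) C suc k ≤ 2 * (n C suc k)
  bound n n₀≤n = begin
    (d + n) C suc k                        ≤⟨ [d+n]C[k+1]≤d*[d+n]Ck+nC[k+1] n d k ⟩
    d * ((d + n) C k) + n C suc k          ≤⟨ +-monoˡ-≤ (n C suc k) excess ⟩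
    n C suc k + n C suc k                  ≡⟨ cong (n C suc k +_) (+-identityʳ _) ⟨
    2 * (n C suc k)                        ∎
    where
    open ≤-Reasoning
    b = n ∸ 2 * d
    2d+b≡n : 2 * d + b ≡ n
    2d+b≡n = m+[n∸m]≡n (m+n≤o⇒m≤o (2 * d) n₀≤n)
    excess : d * ((d + n) C k) ≤ n C suc k
    excess = begin
      d * ((d + n) C k)              ≡⟨ cong (λ m → d * ((d + m) C k)) 2d+b≡n ⟨
      d * ((d + (2 * d + b)) C k)    ≡⟨ cong (λ m → d * (m C k)) (+-assoc d (2 * d) b) ⟨
      d * ((d + 2 * d + b) C k)      ≤⟨ *-monoʳ-≤ d (ih b (m+n≤o⇒m≤o∸n n₀ (subst (_≤ n) (+-comm (2 * d) n₀) n₀≤n))) ⟩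
      d * (2 * (b C k))              ≡⟨ *-assoc d 2 (b C k) ⟨
      d * 2 * (b C k)                ≡⟨ cong (_* (b C k)) (*-comm d 2) ⟩
      2 * d * (b C k)                ≤⟨ d*nCk≤[d+n]C[k+1] b (2 * d) k ⟩
      (2 * d + b) C suc k            ≡⟨ cong (_C suc k) 2d+b≡n ⟩
      n C suc k                      ∎

-- Lists

-- Cut one occurrence of the head `x` out of `ys`. Since `x` does not recur in `xs`, the tail is
-- still contained in what remains, and induction applies.
unique∧⊆⇒length≤ : ∀ {A : Set} {xs ys : List A} →
  Unique xs → xs ⊆ ys → length xs ≤ length ys
unique∧⊆⇒length≤ {xs = []}     _             _     = z≤n
unique∧⊆⇒length≤ {xs = x ∷ xs} u@(_ ∷ uxs) xs⊆ys with ∈-∃++ (xs⊆ys (here refl))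
... | as , bs , refl = begin
  suc (length xs)                ≤⟨ s≤s (unique∧⊆⇒length≤ uxs xs⊆as++bs) ⟩
  suc (length (as ++ bs))        ≡⟨ cong suc (length-++ as) ⟩
  suc (length as + length bs)    ≡⟨ +-suc (length as) (length bs) ⟨
  length as + suc (length bs)    ≡⟨ length-++ as ⟨
  length (as ++ x ∷ bs)          ∎
  where
  open ≤-Reasoning
  xs⊆as++bs : xs ⊆ as ++ bs
  xs⊆as++bs z∈xs with ∈-++⁻ as (xs⊆ys (there z∈xs))
  ... | inj₁ z∈as         = ∈-++⁺ˡ z∈as
  ... | inj₂ (here refl)  = contradiction z∈xs (Unique[x∷xs]⇒x∉xs u)
  ... | inj₂ (there z∈bs) = ∈-++⁺ʳ as z∈bs

module _ {A B : Set} {P : Pred B 0ℓ} {Q : Pred A 0ℓ}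
         (P? : Decidable P) (Q? : Decidable Q) (f : A → B) where

  length-filter-map : (∀ {x} → P (f x) → Q x) → (∀ {x} → Q x → P (f x)) →
    ∀ xs → length (filter P? (map f xs)) ≡ length (filter Q? xs)
  length-filter-map P⇒Q Q⇒P []       = refl
  length-filter-map P⇒Q Q⇒P (x ∷ xs) with P? (f x) | Q? x
  ... | yes _ | yes _ = cong suc (length-filter-map P⇒Q Q⇒P xs)
  ... | no  _ | no  _ = length-filter-map P⇒Q Q⇒P xs
  ... | yes p | no ¬q = contradiction (P⇒Q p) ¬q
  ... | no ¬p | yes q = contradiction (Q⇒P q) ¬p

filter-map-none : ∀ {A B : Set} {P : Pred B 0ℓ} (P? : Decidable P) (f : A → B) →
  (∀ {x} → ¬ P (f x)) → ∀ xs → filter P? (map f xs) ≡ []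
filter-map-none P? f ¬P []       = refl
filter-map-none P? f ¬P (x ∷ xs) with P? (f x)
... | yes p = contradiction p ¬P
... | no  _ = filter-map-none P? f ¬P xs

-- Counting k-subsets

length-kSubsets : ∀ n k → length (kSubsets n k) ≡ n C k
length-kSubsets zero    zero    = refl
length-kSubsets zero    (suc k) = refl
length-kSubsets (suc n) zero    = trans (length-map addOut (kSubsets n 0)) (length-kSubsets n 0)
length-kSubsets (suc n) (suc k) = begin
  length (map addIn I ++ map addOut O)          ≡⟨ length-++ (map addIn I) ⟩
  length (map addIn I) + length (map addOut O)  ≡⟨ cong₂ _+_ (length-map addIn I) (length-map addOut O) ⟩
  length I + length O                           ≡⟨ cong₂ _+_ (length-kSubsets n k) (length-kSubsets n (suc k)) ⟩
  n C k + n C suc k                             ≡⟨ nCk+nC[k+1]≡[n+1]C[k+1] n k ⟩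
  suc n C suc k                                 ∎
  where
  open ≡-Reasoning
  I = kSubsets n k
  O = kSubsets n (suc k)

-- The first set has arbitrary size, so that one count covers both neighbourhoods (a `k`-set) and
-- common neighbourhoods (a union of two `k`-sets). At `t = proj₁ x` this unfolds to adjacency in
-- `Kneser n k`.
Disjoint : ∀ {n k} → Subset n → KSubset n k → Set
Disjoint t s = Empty (t ∩ proj₁ s)

disjoint? : ∀ {n k} (t : Subset n) → Decidable (Disjoint {k = k} t)
disjoint? t s = ¬? (nonempty? (t ∩ proj₁ s))

disjointFrom : ∀ {n} → Subset n → ∀ k → List (KSubset n k)
disjointFrom {n} t k = filter (disjoint? t) (kSubsets n k)

disjointFrom-uniq : ∀ {n} (t : Subset n) k → Unique (disjointFrom t k)
disjointFrom-uniq {n} t k = filter⁺ (disjoint? t) (kSubsets-uniq n k)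

∈-disjointFrom⁺ : ∀ {n k} (t : Subset n) {s : KSubset n k} →
  Disjoint t s → s ∈ disjointFrom t k
∈-disjointFrom⁺ {n} {k} t {s} = ∈-filter⁺ (disjoint? t) (kSubsets-all n k s)

∈-disjointFrom⁻ : ∀ {n k} (t : Subset n) {s : KSubset n k} →
  s ∈ disjointFrom t k → Disjoint t s
∈-disjointFrom⁻ {n} {k} t s∈ = proj₂ (∈-filter⁻ (disjoint? t) {xs = kSubsets n k} s∈)

∷-Empty : ∀ {n} {p : Subset n} → Empty p → Empty (outside ∷ p)
∷-Empty e (suc i , there i∈p) = e (i , i∈p)

length-filter-addOut : ∀ {n k} b (t : Subset n) (ss : List (KSubset n k)) →
  length (filter (disjoint? (b ∷ t)) (map addOut ss)) ≡ length (filter (disjoint? t) ss)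
length-filter-addOut inside  t =
  length-filter-map (disjoint? (inside ∷ t)) (disjoint? t) addOut drop-∷-Empty ∷-Empty
length-filter-addOut outside t =
  length-filter-map (disjoint? (outside ∷ t)) (disjoint? t) addOut drop-∷-Empty ∷-Empty

-- Induction follows the recursion of `kSubsets`. If the first point lies in `t`, only the sets
-- omitting it survive; otherwise both halves survive and Pascal's rule adds their counts.
length-disjointFrom : ∀ {n} (t : Subset n) k → length (disjointFrom t k) ≡ (n ∸ ∣ t ∣) C k
length-disjointFrom []           zero    = refl
length-disjointFrom []           (suc k) = refl
length-disjointFrom {suc n} (inside ∷ t)  zero =
  trans (length-filter-addOut inside t (kSubsets n 0)) (length-disjointFrom t 0)
length-disjointFrom {suc n} (outside ∷ t) zero =
  trans (length-filter-addOut outside t (kSubsets n 0)) (length-disjointFrom t 0)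
length-disjointFrom {suc n} (inside ∷ t)  (suc k) = begin
  length (filter P? (map addIn I ++ map addOut O))
    ≡⟨ cong length (filter-++ P? (map addIn I) (map addOut O)) ⟩
  length (filter P? (map addIn I) ++ filter P? (map addOut O))
    ≡⟨ cong (λ ss → length (ss ++ filter P? (map addOut O)))
            (filter-map-none P? addIn (λ e → e (zero , here)) I) ⟩
  length (filter P? (map addOut O))
    ≡⟨ length-filter-addOut inside t O ⟩
  length (disjointFrom t (suc k))
    ≡⟨ length-disjointFrom t (suc k) ⟩
  (n ∸ ∣ t ∣) C suc k ∎
  where
  open ≡-Reasoning
  I = kSubsets n k
  O = kSubsets n (suc k)
  P? = disjoint? {k = suc k} (inside ∷ t)
length-disjointFrom {suc n} (outside ∷ t) (suc k) = begin
  length (filter P? (map addIn I ++ map addOut O))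
    ≡⟨ cong length (filter-++ P? (map addIn I) (map addOut O)) ⟩
  length (filter P? (map addIn I) ++ filter P? (map addOut O))
    ≡⟨ length-++ (filter P? (map addIn I)) ⟩
  length (filter P? (map addIn I)) + length (filter P? (map addOut O))
    ≡⟨ cong₂ _+_ (length-filter-map P? (disjoint? t) addIn drop-∷-Empty ∷-Empty I)
                 (length-filter-addOut outside t O) ⟩
  length (disjointFrom t k) + length (disjointFrom t (suc k))
    ≡⟨ cong₂ _+_ (length-disjointFrom t k) (length-disjointFrom t (suc k)) ⟩
  (n ∸ ∣ t ∣) C k + (n ∸ ∣ t ∣) C suc k
    ≡⟨ nCk+nC[k+1]≡[n+1]C[k+1] (n ∸ ∣ t ∣) k ⟩
  suc (n ∸ ∣ t ∣) C suc k
    -- Truncated subtraction commutes with `suc` here because `∣ t ∣ ≤ n`.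
    ≡⟨ cong (_C suc k) (+-∸-assoc 1 (∣p∣≤n t)) ⟨
  (suc n ∸ ∣ t ∣) C suc k ∎
  where
  open ≡-Reasoning
  I = kSubsets n k
  O = kSubsets n (suc k)
  P? = disjoint? {k = suc k} (outside ∷ t)

∣p∪q∣≤∣p∣+∣q∣ : ∀ {n} (p q : Subset n) → ∣ p ∪ q ∣ ≤ ∣ p ∣ + ∣ q ∣
∣p∪q∣≤∣p∣+∣q∣ []            []            = z≤n
∣p∪q∣≤∣p∣+∣q∣ (outside ∷ p) (outside ∷ q) = ∣p∪q∣≤∣p∣+∣q∣ p q
∣p∪q∣≤∣p∣+∣q∣ (outside ∷ p) (inside  ∷ q) =
  subst (suc ∣ p ∪ q ∣ ≤_) (sym (+-suc ∣ p ∣ ∣ q ∣)) (s≤s (∣p∪q∣≤∣p∣+∣q∣ p q))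
∣p∪q∣≤∣p∣+∣q∣ (inside  ∷ p) (outside ∷ q) = s≤s (∣p∪q∣≤∣p∣+∣q∣ p q)
∣p∪q∣≤∣p∣+∣q∣ (inside  ∷ p) (inside  ∷ q) =
  s≤s (≤-trans (∣p∪q∣≤∣p∣+∣q∣ p q) (+-monoʳ-≤ ∣ p ∣ (n≤1+n ∣ q ∣)))

∩-antitone-Empty : ∀ {n} {p q r : Subset n} →
  p ⊆ˢ q → Empty (q ∩ r) → Empty (p ∩ r)
∩-antitone-Empty {p = p} {r = r} p⊆q e (i , i∈p∩r) with x∈p∩q⁻ p r i∈p∩r
... | i∈p , i∈r = e (i , x∈p∩q⁺ (p⊆q i∈p , i∈r))

_≟ᴷ_ : ∀ {n k} → DecidableEquality (KSubset n k)
s ≟ᴷ t with ≡-dec _≟ᵇ_ (proj₁ s) (proj₁ t)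
... | yes eq  = yes (KSubset-≡ eq)
... | no  neq = no (neq ∘ cong proj₁)

-- Position sets

module _ (G : Graph) where
  open Graph G

  -- The edge to `y` is a path, so a geodesic to `y` has at most one edge and no vertices besides
  -- `x` and `y`. Here `z` differs from `y` by assumption and from `x` because it is adjacent to
  -- `x`.
  neighbours-IsPositionSet : ∀ {x S} → (∀ {y} → y ∈ S → Adj x y) → IsPositionSet G x S
  neighbours-IsPositionSet {x} adj {y} {z} y∈S z∈S z≢y w (_ , shortest) = on-walk w (shortest edge edge-path)
    where
    edge = adj y∈S ◅ ε
    edge-path : IsPath G edge
    edge-path = ((λ { refl → Adj-irrefl (adj y∈S) }) ∷ []) ∷ [] ∷ []
    z≢x : z ≢ x
    z≢x refl = Adj-irrefl (adj z∈S)
    on-walk : ∀ (v : Walk G x y) → walkLength G v ≤ 1 → z ∉ walkVertices G v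
    on-walk ε           _        (here z≡x)          = z≢x z≡x
    on-walk (_ ◅ ε)     _        (here z≡x)          = z≢x z≡x
    on-walk (_ ◅ ε)     _        (there (here z≡y))  = z≢y z≡y
    on-walk (_ ◅ _ ◅ _) (s≤s ())

  -- Length 0 would force `x ≡ y`, and length 1 would be an edge from `x` to `y`.
  commonNeighbour-geodesic : ∀ {x y z} → x ≢ y → ¬ Adj x y →
    (xz : Adj x z) (zy : Adj z y) → IsGeodesic G (xz ◅ zy ◅ ε)
  commonNeighbour-geodesic {x} {y} {z} x≢y ¬xy xz zy = path , shortest
    where
    path : IsPath G (xz ◅ zy ◅ ε)
    path = ((λ { refl → Adj-irrefl xz }) ∷ x≢y ∷ []) ∷ ((λ { refl → Adj-irrefl zy }) ∷ []) ∷ [] ∷ []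
    shortest : ∀ (w : Walk G x y) → IsPath G w → 2 ≤ walkLength G w
    shortest ε           _ = contradiction refl x≢y
    shortest (xy ◅ ε)    _ = contradiction xy ¬xy
    shortest (_ ◅ _ ◅ _) _ = s≤s (s≤s z≤n)

  -- The vertex `z` is the midpoint of a geodesic from `x` to `y`.
  IsPositionSet-avoids-commonNeighbour : ∀ {x y z S} → IsPositionSet G x S →
    y ∈ S → x ≢ y → ¬ Adj x y → Adj x z → Adj z y → z ∉ S
  IsPositionSet-avoids-commonNeighbour pos y∈S x≢y ¬xy xz zy z∈S =
    pos y∈S z∈S (λ { refl → Adj-irrefl zy }) (xz ◅ zy ◅ ε)
      (commonNeighbour-geodesic x≢y ¬xy xz zy) (there (here refl))

  -- A geodesic contains its own starting point, so the single edge from `x` to `y` already violates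
  -- the position condition.
  IsPositionSet∋x-avoids-neighbours : ∀ {x y S} → IsPositionSet G x S →
    x ∈ S → y ∈ S → ¬ Adj x y
  IsPositionSet∋x-avoids-neighbours {x} {y} pos x∈S y∈S xy =
    pos y∈S x∈S x≢y edge (path , shortest) (here refl)
    where
    x≢y : x ≢ y
    x≢y refl = Adj-irrefl xy
    edge = xy ◅ ε
    path : IsPath G edge
    path = (x≢y ∷ []) ∷ [] ∷ []
    shortest : ∀ (w : Walk G x y) → IsPath G w → 1 ≤ walkLength G w
    shortest ε       _ = contradiction refl x≢y
    shortest (_ ◅ _) _ = s≤s z≤n

-- Position sets in Kneser graphs

module _ {n k : ℕ} .{{_ : NonZero k}} where

  private
    G = Kneser n k
    open Graph G using (Vertex; Adj; Adj-sym)

  adj? : ∀ (x : Vertex) → Decidable (Adj x)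
  adj? x = disjoint? (proj₁ x)

  neighbours : Vertex → List Vertex
  neighbours x = disjointFrom (proj₁ x) k

  length-neighbours : ∀ x → length (neighbours x) ≡ (n ∸ k) C k
  length-neighbours (s , ∣s∣≡k) =
    trans (length-disjointFrom s k) (cong (λ m → (n ∸ m) C k) ∣s∣≡k)

  -- Being disjoint from both sets is the same as being disjoint from their union.
  commonNeighbours : Vertex → Vertex → List Vertex
  commonNeighbours x y = disjointFrom (proj₁ x ∪ proj₁ y) k

  -- Only a lower bound, since `x` and `y` may overlap: their union then has fewer than `k + k`
  -- points, which leaves more room for common neighbours.
  length-commonNeighbours : ∀ x y → (n ∸ (k + k)) C k ≤ length (commonNeighbours x y)
  length-commonNeighbours (s , ∣s∣≡k) (t , ∣t∣≡k) = begin
    (n ∸ (k + k)) C k              ≤⟨ C-monoˡ-≤ k (∸-monoʳ-≤ n ∣s∪t∣≤2k) ⟩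
    (n ∸ ∣ s ∪ t ∣) C k            ≡⟨ length-disjointFrom (s ∪ t) k ⟨
    length (disjointFrom (s ∪ t) k) ∎
    where
    open ≤-Reasoning
    ∣s∪t∣≤2k : ∣ s ∪ t ∣ ≤ k + k
    ∣s∪t∣≤2k = subst (∣ s ∪ t ∣ ≤_) (cong₂ _+_ ∣s∣≡k ∣t∣≡k) (∣p∪q∣≤∣p∣+∣q∣ s t)

  ∈-commonNeighbours⁻ : ∀ x y {z} → z ∈ commonNeighbours x y → Adj x z × Adj y z
  ∈-commonNeighbours⁻ (s , _) (t , _) {z} z∈ =
    ∩-antitone-Empty {r = proj₁ z} (p⊆p∪q t) disj , ∩-antitone-Empty {r = proj₁ z} (q⊆p∪q s t) disj
    where disj = ∈-disjointFrom⁻ (s ∪ t) z∈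

  -- What "large" means for `n`: `k+k≤n` makes the binomials that must be positive so, and `half`
  -- makes the common neighbours of any two vertices at least half of all vertices.
  module _ (k+k≤n : k + k ≤ n) (half : n C k ≤ 2 * ((n ∸ (k + k)) C k)) where

    distantVertex⇒length≤ : ∀ {x y S} → Unique S → IsPositionSet G x S →
      y ∈ S → x ≢ y → ¬ Adj x y → length S ≤ (n ∸ k) C k
    distantVertex⇒length≤ {x} {y} {S} uS pos y∈S x≢y ¬xy = begin
      -- `S` and `N` are disjoint, `N` has at least `m` elements and the graph has at most `m + m`
      -- vertices, so cancelling `m` bounds `S`.
      length S           ≤⟨ +-cancelʳ-≤ m (length S) m S+m≤2m ⟩
      m                  ≤⟨ C-monoˡ-≤ k (∸-monoʳ-≤ n (m≤m+n k k)) ⟩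
      (n ∸ k) C k        ∎
      where
      open ≤-Reasoning
      m = (n ∸ (k + k)) C k
      N = commonNeighbours x y
      S∩N≡∅ : ∀ {z} → ¬ (z ∈ S × z ∈ N)
      S∩N≡∅ {z} (z∈S , z∈N) with ∈-commonNeighbours⁻ x y z∈N
      ... | xz , yz =
        IsPositionSet-avoids-commonNeighbour G pos y∈S x≢y ¬xy xz (Adj-sym {y} {z} yz) z∈S
      S+m≤2m : length S + m ≤ m + m
      S+m≤2m = begin
        length S + m           ≤⟨ +-monoʳ-≤ (length S) (length-commonNeighbours x y) ⟩
        length S + length N    ≡⟨ length-++ S ⟨
        length (S ++ N)        ≤⟨ unique∧⊆⇒length≤
                                    (++⁺ uS (disjointFrom-uniq (proj₁ x ∪ proj₁ y) k) S∩N≡∅)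
                                    (λ {z} _ → kSubsets-all n k z) ⟩
        length (kSubsets n k)  ≡⟨ length-kSubsets n k ⟩
        n C k                  ≤⟨ half ⟩
        2 * m                  ≡⟨ cong (m +_) (+-identityʳ m) ⟩
        m + m                  ∎

    IsPositionSet⇒length≤ : ∀ {x S} → Unique S → IsPositionSet G x S →
      length S ≤ (n ∸ k) C k
    IsPositionSet⇒length≤ {x} {S} uS pos
      with any? (λ y → ¬? (x ≟ᴷ y) ×-dec ¬? (adj? x y)) S
    ... | yes distant with find distant
    ...   | y , y∈S , x≢y , ¬xy = distantVertex⇒length≤ uS pos y∈S x≢y ¬xy
    IsPositionSet⇒length≤ {x} {S} uS pos | no ¬distant with any? (x ≟ᴷ_) S
    -- With no distant vertex, any other member of `S` would be a neighbour of `x`, which `x ∈ S`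
    -- forbids. The resulting bound 1 suffices since `k ≤ n ∸ k`.
    ... | yes x∈S = ≤-trans (unique∧⊆⇒length≤ uS S⊆[x]) (k≤n⇒1≤nCk (m+n≤o⇒m≤o∸n k k+k≤n))
      where
      S⊆[x] : S ⊆ x ∷ []
      S⊆[x] {y} y∈S with x ≟ᴷ y
      ... | yes x≡y = here (sym x≡y)
      ... | no  x≢y = contradiction
        (lose y∈S (x≢y , IsPositionSet∋x-avoids-neighbours G pos x∈S y∈S)) ¬distant
    -- Every member differs from `x` and is not distant, hence is a neighbour of `x`.
    ... | no x∉S = subst (length S ≤_) (length-neighbours x) (unique∧⊆⇒length≤ uS S⊆N)
      where
      S⊆N : S ⊆ neighbours x
      S⊆N {y} y∈S with adj? x y
      ... | yes xy = ∈-disjointFrom⁺ (proj₁ x) xy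
      ... | no ¬xy = contradiction (lose y∈S ((λ { refl → x∉S y∈S }) , ¬xy)) ¬distant

    Kneser-IsPositionNumber : ∀ x → IsPositionNumber G x ((n ∸ k) C k)
    Kneser-IsPositionNumber x =
      ( neighbours x
      , disjointFrom-uniq (proj₁ x) k
      , neighbours-IsPositionSet G (∈-disjointFrom⁻ (proj₁ x))
      , length-neighbours x
      ) , λ { _ (_ , uS , pos , refl) → IsPositionSet⇒length≤ uS pos }

    Kneser-IsVp : IsVp G ((n ∸ k) C k)
    Kneser-IsVp =
      -- The position number is the same at every vertex, so the maximum is attained as soon as some
      -- vertex exists; `k ≤ n` provides one.
      (λ _ → (n ∸ k) C k) , Kneser-IsPositionNumber , (vertex , refl) , λ { _ (_ , refl) → ≤-refl }
      where
      1≤∣V∣ : 1 ≤ length (kSubsets n k)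
      1≤∣V∣ = subst (1 ≤_) (sym (length-kSubsets n k)) (k≤n⇒1≤nCk (m+n≤o⇒m≤o k k+k≤n))
      vertex : Vertex
      vertex = lookup (kSubsets n k) (fromℕ< 1≤∣V∣)

theorem3p8 : (k : ℕ) .{{_ : NonZero k}} →
    ∃[ n₀ ] (∀ (n : ℕ) → n₀ ≤ n → IsVp (Kneser n k) ((n ∸ k) C k))
theorem3p8 k with eventually-[d+n]Ck≤2*nCk k (k + k)
-- The summand `k + k` of the threshold gives `k + k ≤ n`, and `n₁` lets `doubling` be applied at
-- `n ∸ (k + k)`; shifting that by `k + k` returns to `n` and yields `half`.
... | n₁ , doubling = k + k + n₁ , λ n n₀≤n →
  let k+k≤n   = m+n≤o⇒m≤o (k + k) n₀≤n
      n₁≤n∸2k = m+n≤o⇒m≤o∸n n₁ (subst (_≤ n) (+-comm (k + k) n₁) n₀≤n)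
  in Kneser-IsVp k+k≤n
       (subst (λ m → m C k ≤ 2 * ((n ∸ (k + k)) C k)) (m+[n∸m]≡n k+k≤n)
         (doubling (n ∸ (k + k)) n₁≤n∸2k))
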